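{- Let $G$ be an opposite-semicube-isomorphic partial cube that is not antipodal, and let $X$ be an antipodal opposite-semicube-isomorphic partial cube. Then the Cartesian product $G\,\square\,X$ is an opposite-semicube-isomorphic partial cube that is not antipodal.
   Context: All graphs are undirected, connected, simple and finite; $d_G$ is the usual shortest-path distance. The Cartesian product $G\,\square\,X$ has vertex set $V(G)\times V(X)$, with $(g,h)$ adjacent to $(g',h')$ iff either $gg'\in E(G)$ and $h=h'$, or $g=g'$ and $hh'\in E(X)$. A partial cube is a graph isomorphic to an isometric subgraph of some hypercube (a subgraph $H$ of $Q$ is isometric if $d_H(x,y)=d_Q(x,y)$ for all $x,y\in V(H)$). The Djokovi\'c–Winkler relation on $E(G)$ is: $uv\,\Theta\,xy$ iff $d_G(u,x)+d_G(v,y)\ne d_G(u,y)+d_G(v,x)$; in a partial cube it is an equivalence relation, and its classes $E_1,\dots,E_d$ are the $\Theta$-classes. For a $\Theta$-class $E_i$ and an edge $xy\in E_i$, the two (opposite) semicubes associated with $E_i$ are $W_i^0=\{a\in V(G): d_G(x,a)<d_G(y,a)\}$ and $W_i^1=\{a\in V(G): d_G(y,a)<d_G(x,a)\}$ (independent of the choice of $xy\in E_i$ up to interchanging the labels $0,1$). A partial cube $G$ is opposite-semicube-isomorphic if $G[W_i^0]\cong G[W_i^1]$ (induced subgraphs) for every $i\in\{1,\dots,d\}$. A vertex $y$ is a relative antipode of $x$ in $G$ if $d_G(x,y)\ge d_G(x,z)$ for every neighbor $z$ of $y$. $G$ is antipodal if every vertex has exactly one relative antipode. -}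

module Defs where

open import Data.Bool using (Bool; false; true)
import Data.Bool.Properties as Bool
open import Data.Fin using (Fin; zero; suc)
open import Data.Fin.Properties using (_≟_; any?; *↔×; 1↔⊤; 2↔Bool)
open import Data.Irrelevant using ([_])
open import Data.Nat using (ℕ; zero; suc; _+_; _*_; _^_; _≤_; _<_; _<?_; z≤n; s≤s)
open import Data.Product using (Σ-syntax; ∃; ∃-syntax; ∃₂; ∃!; _×_; _,_; proj₁; proj₂)
open import Data.Product.Function.NonDependent.Propositional using (_×-↔_)
open import Data.Refinement using (Refinement; value; value-injective; _,_)
open import Data.Sum using (_⊎_; inj₁; inj₂)
import Data.Sum as Sum
open import Data.Unit using (tt)
open import Data.Vec using (Vec; []; _∷_; replicate)
open import Data.Vec.Properties using (≡-dec)
open import Function using (_∘_)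
open import Function.Bundles using (_↔_; _⇔_; mk↔ₛ′; module Inverse)
open import Function.Construct.Composition using (_↔-∘_)
open import Function.Construct.Symmetry using (↔-sym)
open import Function.Properties.Inverse using (↔⇒↣)
open import Level using (0ℓ)
open import Relation.Binary.Core using (Rel)
open import Relation.Binary.Definitions using (Symmetric; Irreflexive; DecidableEquality)
  renaming (Decidable to Decidable₂)
open import Relation.Binary.PropositionalEquality
  using (_≡_; _≢_; refl; sym; cong; subst)
open import Relation.Nullary using (Dec; yes; no; ¬_; contradiction)
open import Relation.Nullary.Decidable using (map′; via-injection; _×-dec_; _⊎-dec_)
open import Relation.Nullary.Negation using (contradiction-irr)
open import Relation.Unary using (Pred; Decidable)

-- Finite, not necessarily connected; Graph below adds connectedness.
-- Adjacency is used only up to logical equivalence, so _~_ need not be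
-- proof-irrelevant for the graph to be simple.
record SimpleGraph : Set₁ where
  infix 4 _~_ _~?_
  field
    V        : Set
    finite   : ∃[ n ] (V ↔ Fin n)
    _~_      : Rel V 0ℓ
    _~?_     : Decidable₂ _~_
    ~-sym    : Symmetric _~_
    ~-irrefl : Irreflexive _≡_ _~_

  infix 4 _≟ᵛ_
  _≟ᵛ_ : DecidableEquality V
  _≟ᵛ_ = via-injection (↔⇒↣ (proj₂ finite)) _≟_

  anyᵛ? : {P : Pred V 0ℓ} → Decidable P → Dec (∃ P)
  anyᵛ? {P} P? = map′
    (λ (i , p) → from i , p)
    (λ (v , p) → to v , subst P (sym (strictlyInverseʳ v)) p)
    (any? (P? ∘ from))
    where open Inverse (proj₂ finite)

  -- Walk k u v: walks from u to v with k edges.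
  data Walk : ℕ → V → V → Set where
    []  : ∀ {u} → Walk 0 u u
    _∷_ : ∀ {k u v w} → u ~ v → Walk k v w → Walk (suc k) u w

  walk? : ∀ k → Decidable₂ (Walk k)
  walk? zero    u w = map′ (λ { refl → [] }) (λ { [] → refl }) (u ≟ᵛ w)
  walk? (suc k) u w = map′
    (λ (_ , e , p) → e ∷ p) (λ { (e ∷ p) → _ , e , p })
    (anyᵛ? λ v → (u ~? v) ×-dec walk? k v w)

-- Connected graphs are nonempty. (The empty graph would otherwise be an
-- antipodal partial cube, vacuously.)
Connected : SimpleGraph → Set
Connected G = V × ∀ u v → ∃[ k ] Walk k u v
  where open SimpleGraph G

infix 4 _≅_
record _≅_ (G H : SimpleGraph) : Set where
  private
    module G = SimpleGraph G
    module H = SimpleGraph H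
  field
    bij : G.V ↔ H.V
  open Inverse bij public using (to; from)
  field
    adj : ∀ u v → (u G.~ v) ⇔ (to u H.~ to v)

Refinement-finite : ∀ n {P : Pred (Fin n) 0ℓ} → Decidable P →
                    ∃[ k ] (Refinement (Fin n) P ↔ Fin k)
Refinement-finite zero    P? = 0 , mk↔ₛ′ (λ ()) (λ ()) (λ ()) (λ ())
Refinement-finite (suc n) {P} P? with Refinement-finite n (P? ∘ suc) | P? zero
... | k , e | yes p₀ = suc k , mk↔ₛ′ f g f∘g g∘f
  where
  open Inverse e
  f : Refinement (Fin (suc n)) P → Fin (suc k)
  f (zero  , _) = zero
  f (suc i , p) = suc (to (i , p))
  g : Fin (suc k) → Refinement (Fin (suc n)) P
  g zero    = zero , [ p₀ ]
  g (suc j) = let (i , p) = from j in suc i , p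
  f∘g : ∀ j → f (g j) ≡ j
  f∘g zero    = refl
  f∘g (suc j) = cong suc (strictlyInverseˡ j)
  g∘f : ∀ x → g (f x) ≡ x
  g∘f (zero  , _) = refl
  g∘f (suc i , p) = value-injective (cong (suc ∘ value) (strictlyInverseʳ (i , p)))
... | k , e | no ¬p₀ = k , mk↔ₛ′ f g strictlyInverseˡ g∘f
  where
  open Inverse e
  f : Refinement (Fin (suc n)) P → Fin k
  f (zero  , [ p ]) = contradiction-irr p ¬p₀
  f (suc i , p)     = to (i , p)
  g : Fin k → Refinement (Fin (suc n)) P
  g j = let (i , p) = from j in suc i , p
  g∘f : ∀ x → g (f x) ≡ x
  g∘f (zero  , [ p ]) = contradiction-irr p ¬p₀
  g∘f (suc i , p)     = value-injective (cong (suc ∘ value) (strictlyInverseʳ (i , p)))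

Refinement-↔ : {A B : Set} {P : Pred A 0ℓ} (e : A ↔ B) →
               Refinement A P ↔ Refinement B (P ∘ Inverse.from e)
Refinement-↔ {P = P} e = mk↔ₛ′
  (λ { (a , [ p ]) → to a , [ subst P (sym (strictlyInverseʳ a)) p ] })
  (λ { (b , [ p ]) → from b , [ p ] })
  (λ { (b , _) → value-injective (strictlyInverseˡ b) })
  (λ { (a , _) → value-injective (strictlyInverseʳ a) })
  where open Inverse e

-- A vertex set P and an edge set E among the vertices in P.
record Subgraph (G : SimpleGraph) : Set₁ where
  open SimpleGraph G
  field
    P     : Pred V 0ℓ
    P?    : Decidable P
    E     : Rel V 0ℓ
    E?    : Decidable₂ E
    E-sym : Symmetric E
    E⇒P   : ∀ {u v} → E u v → P u
    E⇒~   : ∀ {u v} → E u v → u ~ v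

⟦_⟧ : ∀ {G} → Subgraph G → SimpleGraph
⟦_⟧ {G} H = record
  { V        = Refinement V P
  ; finite   = let (n , e) = finite
                   (k , f) = Refinement-finite n (P? ∘ Inverse.from e)
               in k , (f ↔-∘ Refinement-↔ e)
  ; _~_      = λ u v → E (value u) (value v)
  ; _~?_     = λ u v → E? (value u) (value v)
  ; ~-sym    = E-sym
  ; ~-irrefl = λ { refl e → ~-irrefl refl (E⇒~ e) }
  }
  where
  open SimpleGraph G hiding (_≟ᵛ_; anyᵛ?; Walk; walk?)
  open Subgraph H

induced : (G : SimpleGraph) {P : Pred (SimpleGraph.V G) 0ℓ} → Decidable P → Subgraph G
induced G {P} P? = record
  { P     = P
  ; P?    = P?
  ; E     = λ u v → P u × P v × u ~ v
  ; E?    = λ u v → P? u ×-dec P? v ×-dec u ~? v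
  ; E-sym = λ (p , q , e) → q , p , ~-sym e
  ; E⇒P   = proj₁
  ; E⇒~   = proj₂ ∘ proj₂
  }
  where open SimpleGraph G

least : {P : Pred ℕ 0ℓ} → Decidable P → ∀ n → P n →
        ∃[ k ] P k × (∀ j → P j → k ≤ j)
least P? n p with P? 0
least P? n       p | yes p₀ = 0 , p₀ , λ _ _ → z≤n
least P? zero    p | no ¬p₀ = contradiction p ¬p₀
least {P} P? (suc n) p | no ¬p₀ with least (P? ∘ suc) n p
... | k , pₖ , min = suc k , pₖ , min′
  where
  min′ : ∀ j → P j → suc k ≤ j
  min′ zero    p₀ = contradiction p₀ ¬p₀
  min′ (suc j) pⱼ = s≤s (min j pⱼ)

record Graph : Set₁ where
  constructor mkGraph
  field
    simpleGraph : SimpleGraph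
    connected   : Connected simpleGraph

  open SimpleGraph simpleGraph public

  shortest : ∀ u v → ∃[ k ] Walk k u v × (∀ j → Walk j u v → k ≤ j)
  shortest u v = let (n , w) = proj₂ connected u v in least (λ k → walk? k u v) n w

  dist : V → V → ℕ
  dist u v = proj₁ (shortest u v)

infixr 6 _□_
_□_ : Graph → Graph → Graph
G □ X = mkGraph GX ((proj₁ G.connected , proj₁ X.connected) , walks)
  where
  module G = Graph G
  module X = Graph X

  GX : SimpleGraph
  GX = record
    { V        = G.V × X.V
    ; finite   = let (m , e) = G.finite
                     (n , f) = X.finite
                 in m * n , (↔-sym *↔× ↔-∘ (e ×-↔ f))
    ; _~_      = λ (g , h) (g′ , h′) → (g G.~ g′ × h ≡ h′) ⊎ (g ≡ g′ × h X.~ h′)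
    ; _~?_     = λ (g , h) (g′ , h′) →
                   ((g G.~? g′) ×-dec (h X.≟ᵛ h′)) ⊎-dec ((g G.≟ᵛ g′) ×-dec (h X.~? h′))
    ; ~-sym    = Sum.map (λ (e , q) → G.~-sym e , sym q) (λ (q , e) → sym q , X.~-sym e)
    ; ~-irrefl = λ { refl (inj₁ (e , _)) → G.~-irrefl refl e
                   ; refl (inj₂ (_ , e)) → X.~-irrefl refl e }
    }

  open SimpleGraph GX using (Walk; []; _∷_)

  walkX : ∀ {g k h h′} → X.Walk k h h′ → Walk k (g , h) (g , h′)
  walkX X.[]      = []
  walkX (e X.∷ w) = inj₂ (refl , e) ∷ walkX w

  walkGX : ∀ {j k g g′ h h′} → G.Walk j g g′ → X.Walk k h h′ →
           Walk (j + k) (g , h) (g′ , h′)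
  walkGX G.[]      w = walkX w
  walkGX (e G.∷ v) w = inj₁ (e , refl) ∷ walkGX v w

  walks : ∀ u v → ∃[ k ] Walk k u v
  walks (g , h) (g′ , h′) =
    let (_ , v) = proj₂ G.connected g g′
        (_ , w) = proj₂ X.connected h h′
    in _ , walkGX v w

-- u differs from v in exactly one coordinate.
data Differ₁ : ∀ {n} → Vec Bool n → Vec Bool n → Set where
  here  : ∀ {n b c} {u : Vec Bool n} → b ≢ c → Differ₁ (b ∷ u) (c ∷ u)
  there : ∀ {n b} {u v : Vec Bool n} → Differ₁ u v → Differ₁ (b ∷ u) (b ∷ v)

differ₁? : ∀ {n} → Decidable₂ (Differ₁ {n})
differ₁? []      []      = no λ ()
differ₁? (b ∷ u) (c ∷ v) with b Bool.≟ c
... | yes refl = map′ there (λ { (here b≢b) → contradiction refl b≢b ; (there d) → d })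
                      (differ₁? u v)
... | no b≢c   = map′ (λ { refl → here b≢c })
                      (λ { (here _) → refl ; (there _) → contradiction refl b≢c })
                      (≡-dec Bool._≟_ u v)

Vec-Bool-finite : ∀ n → Vec Bool n ↔ Fin (2 ^ n)
Vec-Bool-finite zero    =
  ↔-sym 1↔⊤ ↔-∘ mk↔ₛ′ (λ _ → tt) (λ _ → []) (λ _ → refl) (λ { [] → refl })
Vec-Bool-finite (suc n) =
  ↔-sym *↔× ↔-∘ ((↔-sym 2↔Bool ×-↔ Vec-Bool-finite n) ↔-∘ uncons-↔)
  where
  uncons-↔ : Vec Bool (suc n) ↔ (Bool × Vec Bool n)
  uncons-↔ = mk↔ₛ′ (λ { (b ∷ u) → b , u }) (λ (b , u) → b ∷ u)
                   (λ _ → refl) (λ { (_ ∷ _) → refl })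

Q : ℕ → Graph
Q n = mkGraph (cube n) (replicate n false , walks)
  where
  differ₁-sym : ∀ {n} → Symmetric (Differ₁ {n})
  differ₁-sym (here b≢c) = here (b≢c ∘ sym)
  differ₁-sym (there d)  = there (differ₁-sym d)

  differ₁-irrefl : ∀ {n} {u : Vec Bool n} → ¬ Differ₁ u u
  differ₁-irrefl (here b≢b) = b≢b refl
  differ₁-irrefl (there d)  = differ₁-irrefl d

  cube : ℕ → SimpleGraph
  cube n = record
    { V        = Vec Bool n
    ; finite   = 2 ^ n , Vec-Bool-finite n
    ; _~_      = Differ₁
    ; _~?_     = differ₁?
    ; ~-sym    = differ₁-sym
    ; ~-irrefl = λ { refl → differ₁-irrefl }
    }

  open module C {n} = SimpleGraph (cube n) using (Walk; []; _∷_)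

  lift : ∀ {n k b} {u v : Vec Bool n} → Walk k u v → Walk k (b ∷ u) (b ∷ v)
  lift []      = []
  lift (d ∷ w) = there d ∷ lift w

  walks : ∀ {n} (u v : Vec Bool n) → ∃[ k ] Walk k u v
  walks []      []      = 0 , []
  walks (b ∷ u) (c ∷ v) with walks u v | b Bool.≟ c
  ... | k , w | yes refl = k , lift w
  ... | k , w | no b≢c   = suc k , here b≢c ∷ lift w

Isometric : (G : Graph) → Subgraph (Graph.simpleGraph G) → Set
Isometric G H = Σ[ c ∈ Connected ⟦ H ⟧ ]
  ∀ x y → Graph.dist (mkGraph ⟦ H ⟧ c) x y ≡ Graph.dist G (value x) (value y)

IsPartialCube : Graph → Set₁
IsPartialCube G = ∃[ n ] Σ[ H ∈ Subgraph (Graph.simpleGraph (Q n)) ]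
  Isometric (Q n) H × Graph.simpleGraph G ≅ ⟦ H ⟧

module _ (G : Graph) where
  open Graph G

  -- An edge occurs once for each orientation; Θ does not depend on the
  -- orientations.
  Edge : Set
  Edge = ∃₂ λ u v → u ~ v

  Θ : Rel Edge 0ℓ
  Θ (u , v , _) (x , y , _) = dist u x + dist v y ≢ dist u y + dist v x

  ΘClass : Edge → Pred Edge 0ℓ
  ΘClass e f = Θ e f

  semicube : V → V → SimpleGraph
  semicube x y = ⟦ induced simpleGraph {λ a → dist x a < dist y a} (λ a → dist x a <? dist y a) ⟧

  -- Each Θ-class is given by a representative e. In a partial cube its two
  -- semicubes do not depend, up to order, on the edge xy of the class, so
  -- quantifying over all such edges is harmless.
  OppositeSemicubeIsomorphic : Set
  OppositeSemicubeIsomorphic =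
    ∀ e x y (xy : x ~ y) → ΘClass e (x , y , xy) → semicube x y ≅ semicube y x

  RelativeAntipode : Rel V 0ℓ
  RelativeAntipode x y = ∀ z → y ~ z → dist x z ≤ dist x y

  Antipodal : Set
  Antipodal = ∀ x → ∃! _≡_ (RelativeAntipode x)

record IsOppositeSemicubeIsomorphicPartialCube (G : Graph) : Set₁ where
  field
    isPartialCube : IsPartialCube G
    isomorphic    : OppositeSemicubeIsomorphic G

{-# OPTIONS --safe #-}
-- Distances in G □ X are sums of the distances in the factors. Hence isometric
-- embeddings of the factors into hypercubes concatenate to one of G □ X; the
-- semicubes of an edge in the G-direction are W × V(X) with W a semicube of G
-- (and symmetrically for X), so isomorphisms extend by the identity; and y is
-- a relative antipode of x in G □ X iff it is one in each coordinate, so that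
-- antipodality of G □ X passes to G.
module Submission where

open import Defs
open import Data.Bool using (Bool)
open import Data.Irrelevant using ([_])
open import Data.Nat using (ℕ; suc; _+_; _≤_; _<_)
open import Data.Nat.Properties
  using (_<?_; +-suc; +-cancelˡ-≤; +-cancelʳ-≤; +-cancelʳ-<; +-mono-≤; +-monoˡ-≤; +-monoʳ-≤;
         +-monoˡ-<; ≤-antisym; ≤-reflexive; ≤-trans; n≤0⇒n≡0; n≢0⇒n>0)
open import Data.Product using (Σ-syntax; ∃-syntax; _×_; _,_; proj₁; proj₂; swap; map₁; map₂)
open import Data.Refinement using (value; value-injective; _,_)
open import Data.Sum using (_⊎_; inj₁; inj₂)
import Data.Sum as Sum
open import Data.Vec using (Vec; []; _∷_; _++_; take; drop)
open import Data.Vec.Properties using (++-injective; take++drop≡id)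
open import Function using (_∘_)
open import Function.Bundles using (mk↔ₛ′; mk⇔; module Inverse; module Equivalence)
open import Level using (0ℓ)
open import Relation.Binary.PropositionalEquality
  using (_≡_; _≢_; refl; sym; trans; cong; cong₂; subst; subst₂; module ≡-Reasoning)
open import Relation.Nullary using (¬_; recompute)
open import Relation.Unary using (Pred; Decidable)

-- Graph isomorphisms and transport of walks.

module _ {G H : SimpleGraph} where
  private
    module G = SimpleGraph G
    module H = SimpleGraph H

  -- Edge preservation by `f` and by `g` is enough: `f` reflects edges because `g` sends them back,
  -- up to rewriting along `g∘f`.
  mk≅ : (f : G.V → H.V) (g : H.V → G.V) →
        (∀ {u v} → u G.~ v → f u H.~ f v) → (∀ {u v} → u H.~ v → g u G.~ g v) →
        (∀ v → f (g v) ≡ v) → (∀ u → g (f u) ≡ u) → G ≅ H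
  mk≅ f g f-hom g-hom f∘g g∘f = record
    { bij = mk↔ₛ′ f g f∘g g∘f
    ; adj = λ u v → mk⇔ f-hom (subst₂ G._~_ (g∘f u) (g∘f v) ∘ g-hom)
    }

  walk-map : (f : G.V → H.V) → (∀ {u v} → u G.~ v → f u H.~ f v) →
             ∀ {k u v} → G.Walk k u v → H.Walk k (f u) (f v)
  walk-map f f-hom G.[]      = H.[]
  walk-map f f-hom (e G.∷ w) = f-hom e H.∷ walk-map f f-hom w

module Iso {G H : SimpleGraph} (i : G ≅ H) where
  private
    module G = SimpleGraph G
    module H = SimpleGraph H
  open _≅_ i using (bij; adj; to; from) public
  open Inverse bij using ()
    renaming (strictlyInverseˡ to to∘from; strictlyInverseʳ to from∘to) public

  to-~ : ∀ {u v} → u G.~ v → to u H.~ to v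
  to-~ = Equivalence.to (adj _ _)

  from-~ : ∀ {u v} → u H.~ v → from u G.~ from v
  from-~ e = Equivalence.from (adj _ _)
    (subst₂ H._~_ (sym (to∘from _)) (sym (to∘from _)) e)

≅-sym : ∀ {G H} → G ≅ H → H ≅ G
≅-sym i = mk≅ from to from-~ to-~ from∘to to∘from
  where open Iso i

≅-trans : ∀ {G H K} → G ≅ H → H ≅ K → G ≅ K
≅-trans i j = mk≅ (j.to ∘ i.to) (i.from ∘ j.from) (j.to-~ ∘ i.to-~) (i.from-~ ∘ j.from-~)
  (λ v → trans (cong j.to (i.to∘from _)) (j.to∘from v))
  (λ u → trans (cong i.from (j.from∘to _)) (i.from∘to u))
  where
  module i = Iso i
  module j = Iso j

≅-connected : ∀ {G H} → G ≅ H → Connected G → Connected H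
≅-connected {H = H} i (v₀ , walks) = to v₀ , λ u v → map₂
  (subst₂ (SimpleGraph.Walk H _) (to∘from u) (to∘from v) ∘ walk-map to to-~)
  (walks (from u) (from v))
  where open Iso i

-- Shortest-path distance.

module Distance (G : Graph) where
  open Graph G

  dist-walk : ∀ u v → Walk (dist u v) u v
  dist-walk u v = proj₁ (proj₂ (shortest u v))

  dist-≤ : ∀ {k u v} → Walk k u v → dist u v ≤ k
  dist-≤ {u = u} {v} = proj₂ (proj₂ (shortest u v)) _

  dist-refl : ∀ u → dist u u ≡ 0
  dist-refl u = n≤0⇒n≡0 (dist-≤ [])

  dist≡0⇒≡ : ∀ {u v} → dist u v ≡ 0 → u ≡ v
  dist≡0⇒≡ {u} {v} eq with [] ← subst (λ k → Walk k u v) eq (dist-walk u v) = refl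

  ~⇒dist≡1 : ∀ {u v} → u ~ v → dist u v ≡ 1
  ~⇒dist≡1 {u} {v} e = ≤-antisym (dist-≤ (e ∷ []))
    (n≢0⇒n>0 λ eq → ~-irrefl (dist≡0⇒≡ eq) e)

  -- Together with `~⇒dist≡1` this makes adjacency a property of distance, so distance-preserving
  -- maps both preserve and reflect edges.
  dist≡1⇒~ : ∀ {u v} → dist u v ≡ 1 → u ~ v
  dist≡1⇒~ {u} {v} eq with e ∷ [] ← subst (λ k → Walk k u v) eq (dist-walk u v) = e

module _ (G H : Graph) where
  private
    module G = Graph G
    module H = Graph H
    module DG = Distance G
    module DH = Distance H

  ≅-dist : (i : G.simpleGraph ≅ H.simpleGraph) → let open _≅_ i in
           ∀ u v → G.dist u v ≡ H.dist (to u) (to v)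
  ≅-dist i u v = ≤-antisym
    (DG.dist-≤ (subst₂ (G.Walk _) (from∘to u) (from∘to v)
                 (walk-map from from-~ (DH.dist-walk (to u) (to v)))))
    (DH.dist-≤ (walk-map to to-~ (DG.dist-walk u v)))
    where open Iso i

-- Induced subgraphs and isometric embeddings.

-- The membership proof stored in a refinement is irrelevant; decidability of `P` recomputes a
-- relevant one.
satisfies : ∀ {G} (H : Subgraph G) (v : SimpleGraph.V ⟦ H ⟧) → Subgraph.P H (value v)
satisfies H (v , [ p ]) = recompute (Subgraph.P? H v) p

module _ (G : SimpleGraph) {P : Pred (SimpleGraph.V G) 0ℓ} (P? : Decidable P) where
  private
    module G = SimpleGraph G
    H = induced G P?

  induced-~ : (u v : SimpleGraph.V ⟦ H ⟧) → value u G.~ value v →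
              SimpleGraph._~_ ⟦ H ⟧ u v
  induced-~ u v e = satisfies H u , satisfies H v , e

-- Partial cubes are handled through such vertex maps into `Q n`, which compose and concatenate more
-- easily than subgraphs.
IsometricMap : (G K : Graph) → (Graph.V G → Graph.V K) → Set
IsometricMap G K φ = ∀ u v → Graph.dist G u v ≡ Graph.dist K (φ u) (φ v)

module _ (G K : Graph) (φ : Graph.V G → Graph.V K) (isom : IsometricMap G K φ) where
  private
    module G = Graph G
    module K = Graph K
    module DG = Distance G
    module DK = Distance K

    φ-injective : ∀ {u v} → φ u ≡ φ v → u ≡ v
    φ-injective {u} {v} eq = DG.dist≡0⇒≡
      (trans (isom u v) (trans (cong (K.dist (φ u)) (sym eq)) (DK.dist-refl (φ u))))

    image? : Decidable (λ v → ∃[ u ] φ u ≡ v)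
    image? v = G.anyᵛ? λ u → φ u K.≟ᵛ v

  image : Subgraph K.simpleGraph
  image = induced K.simpleGraph image?

  -- Distance zero is equality, which gives injectivity of `φ`; distance one is adjacency, so the
  -- edges of the image are exactly those induced from `K`.
  ≅-image : G.simpleGraph ≅ ⟦ image ⟧
  ≅-image = mk≅ inj (λ v → proj₁ (satisfies image v))
    (λ {u} {v} e → induced-~ K.simpleGraph image? (inj u) (inj v)
       (DK.dist≡1⇒~ (trans (sym (isom u v)) (DG.~⇒dist≡1 e))))
    (λ { {u} {v} (_ , _ , e) → DG.dist≡1⇒~ (trans (isom _ _)
       (DK.~⇒dist≡1 (subst₂ K._~_ (sym (φ∘preimage u)) (sym (φ∘preimage v)) e))) })
    (λ v → value-injective (φ∘preimage v))
    (λ u → φ-injective (φ∘preimage (inj u)))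
    where
    inj : G.V → SimpleGraph.V ⟦ image ⟧
    inj u = φ u , [ u , refl ]
    φ∘preimage : ∀ v → φ (proj₁ (satisfies image v)) ≡ value v
    φ∘preimage v = proj₂ (satisfies image v)

  image-isometric : Isometric K image
  image-isometric = c , λ x y → trans
    (≅-dist (mkGraph ⟦ image ⟧ c) G (≅-sym ≅-image) x y)
    (trans (isom _ _) (cong₂ K.dist (proj₂ (satisfies image x)) (proj₂ (satisfies image y))))
    where c = ≅-connected ≅-image G.connected

isometric⇒partialCube : ∀ G n φ → IsometricMap G (Q n) φ → IsPartialCube G
isometric⇒partialCube G n φ isom =
  n , image G (Q n) φ isom , image-isometric G (Q n) φ isom , ≅-image G (Q n) φ isom

partialCube⇒isometric : ∀ G → IsPartialCube G → ∃[ n ] Σ[ φ ∈ _ ] IsometricMap G (Q n) φ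
partialCube⇒isometric G (n , H , (c , isom) , i) = n , value ∘ to , λ u v →
  trans (≅-dist G (mkGraph ⟦ H ⟧ c) i u v) (isom (to u) (to v))
  where open _≅_ i

-- Distances in Cartesian products.

module _ (G X : Graph) where
  private
    module G = Graph G
    module X = Graph X
    module GX = Graph (G □ X)
    module DG = Distance G
    module DX = Distance X
    module DGX = Distance (G □ X)

    walk-++ : ∀ {j k u v w} → GX.Walk j u v → GX.Walk k v w → GX.Walk (j + k) u w
    walk-++ GX.[]      q = q
    walk-++ (e GX.∷ p) q = e GX.∷ walk-++ p q

  -- Every edge of the product moves exactly one coordinate, so each step of the walk is charged to
  -- one of its two projections.
  □-split : ∀ {k g g′ h h′} → GX.Walk k (g , h) (g′ , h′) →
            ∃[ i ] ∃[ j ] i + j ≡ k × G.Walk i g g′ × X.Walk j h h′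
  □-split GX.[] = 0 , 0 , refl , G.[] , X.[]
  □-split (inj₁ (e , refl) GX.∷ w) with i , j , refl , p , q ← □-split w =
    suc i , j , refl , e G.∷ p , q
  □-split (inj₂ (refl , e) GX.∷ w) with i , j , refl , p , q ← □-split w =
    i , suc j , +-suc i j , p , e X.∷ q

  -- For the upper bound, follow a geodesic of `G` and then one of `X`; for the lower bound, split a
  -- geodesic of the product by `□-split`.
  dist-□ : ∀ g h g′ h′ → GX.dist (g , h) (g′ , h′) ≡ G.dist g g′ + X.dist h h′
  dist-□ g h g′ h′ = ≤-antisym
    (DGX.dist-≤ (walk-++
      (walk-map (_, h) (λ e → inj₁ (e , refl)) (DG.dist-walk g g′))
      (walk-map (g′ ,_) (λ e → inj₂ (refl , e)) (DX.dist-walk h h′))))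
    lower
    where
    lower : G.dist g g′ + X.dist h h′ ≤ GX.dist (g , h) (g′ , h′)
    lower with _ , _ , eq , p , q ← □-split (DGX.dist-walk (g , h) (g′ , h′)) =
      ≤-trans (+-mono-≤ (DG.dist-≤ p) (DX.dist-≤ q)) (≤-reflexive eq)

-- Reduces edges in the `X`-direction to edges in the first factor.
□-comm : ∀ G X → Graph.simpleGraph (G □ X) ≅ Graph.simpleGraph (X □ G)
□-comm G X = mk≅ swap swap (Sum.map swap swap ∘ Sum.swap) (Sum.map swap swap ∘ Sum.swap)
  (λ _ → refl) (λ _ → refl)

-- Concatenation of hypercubes and products of partial cubes.

-- Inversion with variable tails: in `differ₁-++⁻` a direct match would have to unify `u ++ v` with
-- `u′ ++ v′`, whereas here that becomes a propositional equation.
differ₁-∷⁻ : ∀ {n b c} {u v : Vec Bool n} → Differ₁ (b ∷ u) (c ∷ v) →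
             (b ≢ c × u ≡ v) ⊎ (b ≡ c × Differ₁ u v)
differ₁-∷⁻ (here b≢c) = inj₁ (b≢c , refl)
differ₁-∷⁻ (there d)  = inj₂ (refl , d)

differ₁-++⁻ : ∀ {m n} (u u′ : Vec Bool m) {v v′ : Vec Bool n} →
              Differ₁ (u ++ v) (u′ ++ v′) →
              (Differ₁ u u′ × v ≡ v′) ⊎ (u ≡ u′ × Differ₁ v v′)
differ₁-++⁻ []      []        d = inj₂ (refl , d)
differ₁-++⁻ (b ∷ u) (c ∷ u′) d with differ₁-∷⁻ d
... | inj₁ (b≢c , eq) with refl , v≡v′ ← ++-injective u u′ eq = inj₁ (here b≢c , v≡v′)
... | inj₂ (refl , d′) =
  Sum.map (map₁ there) (map₁ (cong (b ∷_))) (differ₁-++⁻ u u′ d′)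

differ₁-++ˡ : ∀ {m n} {u u′ : Vec Bool m} {v : Vec Bool n} →
              Differ₁ u u′ → Differ₁ (u ++ v) (u′ ++ v)
differ₁-++ˡ (here b≢c) = here b≢c
differ₁-++ˡ (there d)  = there (differ₁-++ˡ d)

differ₁-++ʳ : ∀ {m n} (u : Vec Bool m) {v v′ : Vec Bool n} →
              Differ₁ v v′ → Differ₁ (u ++ v) (u ++ v′)
differ₁-++ʳ []      d = d
differ₁-++ʳ (b ∷ u) d = there (differ₁-++ʳ u d)

-- Allows `dist-□` to be applied to cubes themselves, so the distance between concatenated vectors
-- is obtained without computing Hamming distances.
Q-□ : ∀ m n → Graph.simpleGraph (Q m □ Q n) ≅ Graph.simpleGraph (Q (m + n))
Q-□ m n = mk≅ (λ (u , v) → u ++ v) (λ w → take m w , drop m w)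
  (λ { (inj₁ (d , refl)) → differ₁-++ˡ d ; {u , _} (inj₂ (refl , d)) → differ₁-++ʳ u d })
  (λ {w} {w′} d → differ₁-++⁻ (take m w) (take m w′)
    (subst₂ Differ₁ (sym (take++drop≡id m w)) (sym (take++drop≡id m w′)) d))
  (take++drop≡id m)
  (λ (u , v) → let (p , q) = ++-injective (take m (u ++ v)) u (take++drop≡id m (u ++ v))
               in cong₂ _,_ p q)

□-isPartialCube : ∀ G X → IsPartialCube G → IsPartialCube X → IsPartialCube (G □ X)
□-isPartialCube G X pG pX
  with m , φ , φ-isom ← partialCube⇒isometric G pG
     | n , ψ , ψ-isom ← partialCube⇒isometric X pX =
  isometric⇒partialCube (G □ X) (m + n) (λ (g , h) → φ g ++ ψ h) isom
  where
  open ≡-Reasoning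
  isom : IsometricMap (G □ X) (Q (m + n)) (λ (g , h) → φ g ++ ψ h)
  isom (g , h) (g′ , h′) = begin
    Graph.dist (G □ X) (g , h) (g′ , h′)
      ≡⟨ dist-□ G X g h g′ h′ ⟩
    Graph.dist G g g′ + Graph.dist X h h′
      ≡⟨ cong₂ _+_ (φ-isom g g′) (ψ-isom h h′) ⟩
    Graph.dist (Q m) (φ g) (φ g′) + Graph.dist (Q n) (ψ h) (ψ h′)
      ≡⟨ dist-□ (Q m) (Q n) (φ g) (ψ h) (φ g′) (ψ h′) ⟨
    Graph.dist (Q m □ Q n) (φ g , ψ h) (φ g′ , ψ h′)
      ≡⟨ ≅-dist (Q m □ Q n) (Q (m + n)) (Q-□ m n) _ _ ⟩
    Graph.dist (Q (m + n)) (φ g ++ ψ h) (φ g′ ++ ψ h′) ∎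

-- Semicubes of products.

semicube-~ : ∀ G x y (u v : SimpleGraph.V (semicube G x y)) →
             Graph._~_ G (value u) (value v) → SimpleGraph._~_ (semicube G x y) u v
semicube-~ G x y = induced-~ (Graph.simpleGraph G) (λ a → Graph.dist G x a <? Graph.dist G y a)

-- Membership in a semicube is a comparison of distances, and isomorphisms preserve distances.
semicube-cong : ∀ G H (i : Graph.simpleGraph G ≅ Graph.simpleGraph H) → let open _≅_ i in
                ∀ x y x′ y′ → to x ≡ x′ → to y ≡ y′ → semicube G x y ≅ semicube H x′ y′
semicube-cong G H i x y _ _ refl refl = mk≅ f g
  (λ {u} {v} (_ , _ , e) → semicube-~ H (to x) (to y) (f u) (f v) (to-~ e))
  (λ {u} {v} (_ , _ , e) → semicube-~ G x y (g u) (g v) (from-~ e))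
  (λ (a , _) → value-injective (to∘from a))
  (λ (a , _) → value-injective (from∘to a))
  where
  open Iso i
  eq : ∀ u v → Graph.dist G u v ≡ Graph.dist H (to u) (to v)
  eq = ≅-dist G H i
  eq′ : ∀ u b → Graph.dist H (to u) b ≡ Graph.dist G u (from b)
  eq′ u b = trans (cong (Graph.dist H (to u)) (sym (to∘from b))) (sym (eq u (from b)))
  f : SimpleGraph.V (semicube G x y) → SimpleGraph.V (semicube H (to x) (to y))
  f (a , [ p ]) = to a , [ subst₂ _<_ (eq x a) (eq y a) p ]
  g : SimpleGraph.V (semicube H (to x) (to y)) → SimpleGraph.V (semicube G x y)
  g (b , [ p ]) = from b , [ subst₂ _<_ (eq′ x b) (eq′ y b) p ]

module _ (G X : Graph) (h : Graph.V X) where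
  private
    module G = Graph G
    module X = Graph X
    module GX = Graph (G □ X)

    -- Both sides contain the summand `X.dist h b`, which cancels; membership of `(a , b)` thus
    -- depends on `a` alone.
    project : ∀ {x y a b} → GX.dist (x , h) (a , b) < GX.dist (y , h) (a , b) →
              G.dist x a < G.dist y a
    project {x} {y} {a} {b} =
      +-cancelʳ-< (X.dist h b) _ _ ∘ subst₂ _<_ (dist-□ G X x h a b) (dist-□ G X y h a b)

    extend : ∀ {x y a b} → G.dist x a < G.dist y a →
             GX.dist (x , h) (a , b) < GX.dist (y , h) (a , b)
    extend {x} {y} {a} {b} =
      subst₂ _<_ (sym (dist-□ G X x h a b)) (sym (dist-□ G X y h a b)) ∘ +-monoˡ-< (X.dist h b)

    S : G.V → G.V → Set
    S x y = SimpleGraph.V (semicube G x y)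

    S□ : G.V → G.V → Set
    S□ x y = SimpleGraph.V (semicube (G □ X) (x , h) (y , h))

    module _ {x y x′ y′ : G.V} (f : S x y → S x′ y′) where
      lift : S□ x y → S□ x′ y′
      lift ((a , b) , [ p ]) = let (a′ , [ p′ ]) = f (a , [ project p ]) in
        (a′ , b) , [ extend p′ ]

      lift-~ : (∀ u v → SimpleGraph._~_ (semicube G x y) u v →
                          SimpleGraph._~_ (semicube G x′ y′) (f u) (f v)) →
               ∀ u v → SimpleGraph._~_ (semicube (G □ X) (x , h) (y , h)) u v →
                         SimpleGraph._~_ (semicube (G □ X) (x′ , h) (y′ , h)) (lift u) (lift v)
      lift-~ f-hom u v (p , q , inj₁ (e , refl)) =
        semicube-~ (G □ X) _ _ (lift u) (lift v)
          (let (_ , _ , e′) = f-hom (_ , [ project p ]) (_ , [ project q ])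
                                    (project p , project q , e)
           in inj₁ (e′ , refl))
      -- Both endpoints have the same `G`-coordinate and membership proofs are irrelevant, so `f`
      -- receives definitionally equal arguments and `refl` suffices.
      lift-~ f-hom u v (p , q , inj₂ (refl , e)) =
        semicube-~ (G □ X) _ _ (lift u) (lift v) (inj₂ (refl , e))

  semicube-□ : ∀ x y x′ y′ → semicube G x y ≅ semicube G x′ y′ →
               semicube (G □ X) (x , h) (y , h) ≅ semicube (G □ X) (x′ , h) (y′ , h)
  semicube-□ x y x′ y′ i = mk≅ (lift to) (lift from)
    (λ {u} {v} → lift-~ to (λ u v → to-~ {u} {v}) u v)
    (λ {u} {v} → lift-~ from (λ u v → from-~ {u} {v}) u v)
    (λ ((a , b) , [ p ]) → value-injective (cong (λ s → value s , b) (to∘from (a , [ project p ]))))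
    (λ ((a , b) , [ p ]) → value-injective (cong (λ s → value s , b) (from∘to (a , [ project p ]))))
    where open Iso i

module _ (G : Graph) where
  open Graph G
  open Distance G

  -- The two sums are 0 + 0 and 1 + 1. Hence every edge can represent its own class, which is how
  -- the hypothesis is applied to a given edge in `opposite-≅`.
  Θ-refl : ∀ e → Θ G e e
  Θ-refl (u , v , e) eq
    with () ← trans (sym (cong₂ _+_ (dist-refl u) (dist-refl v)))
                (trans eq (cong₂ _+_ (~⇒dist≡1 e) (~⇒dist≡1 (~-sym e))))

  opposite-≅ : OppositeSemicubeIsomorphic G → ∀ x y → x ~ y → semicube G x y ≅ semicube G y x
  opposite-≅ iso x y e = iso (x , y , e) x y e (Θ-refl (x , y , e))

-- Semicubes and their vertices are passed explicitly: semicube unfolds to a large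
-- record, which Agda can neither invert nor compare cheaply.
□-oppositeSemicubeIsomorphic : ∀ G X → OppositeSemicubeIsomorphic G →
  OppositeSemicubeIsomorphic X → OppositeSemicubeIsomorphic (G □ X)
□-oppositeSemicubeIsomorphic G X isoG isoX _ (g , h) (g′ , _) (inj₁ (e , refl)) _ =
  semicube-□ G X h g g′ g′ g (opposite-≅ G isoG g g′ e)
□-oppositeSemicubeIsomorphic G X isoG isoX _ (g , h) (_ , h′) (inj₂ (refl , e)) _ =
  ≅-trans {semicube (G □ X) (g , h) (g , h′)} {semicube (X □ G) (h , g) (h′ , g)}
          {semicube (G □ X) (g , h′) (g , h)}
    (semicube-cong (G □ X) (X □ G) (□-comm G X) (g , h) (g , h′) (h , g) (h′ , g) refl refl)
    (≅-trans {semicube (X □ G) (h , g) (h′ , g)} {semicube (X □ G) (h′ , g) (h , g)}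
             {semicube (G □ X) (g , h′) (g , h)}
      (semicube-□ X G g h h′ h′ h (opposite-≅ X isoX h h′ e))
      (semicube-cong (X □ G) (G □ X) (□-comm X G) (h′ , g) (h , g) (g , h′) (g , h) refl refl))

-- Relative antipodes in products.

module _ (G X : Graph) where
  private
    module G = Graph G
    module X = Graph X
    module GX = Graph (G □ X)

  -- A neighbour of `(g′ , h′)` keeps one coordinate, so one summand of the distance is unchanged
  -- and the other is bounded in its factor. The converse cancels the unchanged summand.
  relativeAntipode-□⁺ : ∀ {g h g′ h′} → RelativeAntipode G g g′ → RelativeAntipode X h h′ →
                        RelativeAntipode (G □ X) (g , h) (g′ , h′)
  relativeAntipode-□⁺ {g} {h} {g′} {h′} rG rX (a , b) e =
    subst₂ _≤_ (sym (dist-□ G X g h a b)) (sym (dist-□ G X g h g′ h′)) (bound e)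
    where
    bound : (g′ , h′) GX.~ (a , b) → G.dist g a + X.dist h b ≤ G.dist g g′ + X.dist h h′
    bound (inj₁ (e , refl)) = +-monoˡ-≤ (X.dist h h′) (rG a e)
    bound (inj₂ (refl , e)) = +-monoʳ-≤ (G.dist g g′) (rX b e)

  relativeAntipode-□⁻ : ∀ {g h g′ h′} → RelativeAntipode (G □ X) (g , h) (g′ , h′) →
                        RelativeAntipode G g g′ × RelativeAntipode X h h′
  relativeAntipode-□⁻ {g} {h} {g′} {h′} r =
      (λ a e → +-cancelʳ-≤ (X.dist h h′) _ _ (bound (inj₁ (e , refl))))
    , (λ b e → +-cancelˡ-≤ (G.dist g g′) _ _ (bound (inj₂ (refl , e))))
    where
    bound : ∀ {a b} → (g′ , h′) GX.~ (a , b) →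
            G.dist g a + X.dist h b ≤ G.dist g g′ + X.dist h h′
    bound {a} {b} e = subst₂ _≤_ (dist-□ G X g h a b) (dist-□ G X g h g′ h′) (r (a , b) e)

  □-antipodal⁻ˡ : Antipodal (G □ X) → Antipodal G
  -- The second coordinate is an arbitrary vertex of `X`, supplied by nonemptiness.
  □-antipodal⁻ˡ anti g with (g′ , h′) , r , unique ← anti (g , proj₁ X.connected)
    with rG , rX ← relativeAntipode-□⁻ r =
    -- Any rival antipode of `g`, paired with the same `h′`, is an antipode in the product, where
    -- uniqueness applies.
    g′ , rG , λ rG′ → cong proj₁ (unique (relativeAntipode-□⁺ rG′ rX))

theorem4p2 : (G X : Graph) →
    IsOppositeSemicubeIsomorphicPartialCube G → ¬ Antipodal G →
    IsOppositeSemicubeIsomorphicPartialCube X → Antipodal X →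
    IsOppositeSemicubeIsomorphicPartialCube (G □ X) × ¬ Antipodal (G □ X)
theorem4p2 G X pG ¬anti pX _ =
  record
    { isPartialCube = □-isPartialCube G X pG.isPartialCube pX.isPartialCube
    ; isomorphic    = □-oppositeSemicubeIsomorphic G X pG.isomorphic pX.isomorphic
    } , ¬anti ∘ □-antipodal⁻ˡ G X
  where
  module pG = IsOppositeSemicubeIsomorphicPartialCube pG
  module pX = IsOppositeSemicubeIsomorphicPartialCube pX
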